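{- Let $(P,\leq)$ be a finite supersolvable join-distributive lattice. Then $P$ is maximal.
   Context: A finite lattice is join-distributive if for every element $x$ and every set $Y$ of elements covering $x$ the interval $[x,\bigvee_{y\in Y}y]$ is boolean (isomorphic to the lattice of all subsets of a finite set). A finite lattice $P$ is supersolvable if it has a maximal chain $\mathfrak{m}$ such that for every maximal chain $\mathfrak{c}$ of $P$ the sublattice generated by $\mathfrak{m}\cup\mathfrak{c}$ is distributive. A finite join-distributive lattice is graded. A finite graded lattice $(P,\leq)$ with rank function $\mathrm{rk}:P\to\mathbb{Z}$ is called maximal if the addition of any finite collection of cover relations of the form $x\prec y$ with $\mathrm{rk}(y)=\mathrm{rk}(x)+1$ yields a nonlattice. Here the collection is nonempty and consists of new relations: pairs $(x,y)$ with $x\not\leq y$ in $P$; the resulting poset is the reflexive transitive closure of $\leq$ together with the added relations. -}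

module Defs where

open import Data.Fin.Base using (Fin)
open import Data.Fin.Subset using (Subset; _⊆_)
open import Data.Integer.Base using (ℤ; 1ℤ; _+_)
open import Data.List.Base using (List; []; foldr)
open import Data.List.Membership.Propositional using () renaming (_∈_ to _∈ₚ_)
import Data.List.Membership.Setoid as SetoidMembership
open import Data.List.Relation.Unary.All using (All)
open import Data.Nat.Base using (ℕ)
open import Data.Product.Base using (Σ-syntax; ∃-syntax; _×_; _,_; proj₁)
open import Data.Sum.Base using (_⊎_)
open import Function.Base using (_on_)
open import Function.Bundles using (Inverse)
open import Level using (_⊔_)
open import Relation.Binary.Core using (Rel)
open import Relation.Binary.Construct.Closure.ReflexiveTransitive using (Star)
import Relation.Binary.Construct.NonStrictToStrict as ToStrict
open import Relation.Binary.Lattice.Bundles using (Lattice)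
open import Relation.Binary.Lattice.Structures using (IsLattice)
open import Relation.Binary.Morphism.Structures using (IsOrderIsomorphism)
open import Relation.Binary.PropositionalEquality.Core using (_≡_; _≢_)
open import Relation.Binary.PropositionalEquality.Properties using (setoid)
open import Relation.Nullary.Negation.Core using (¬_)

-- Since the lattices below are finite, their subsets are represented by lists
-- of elements; order and repetition are irrelevant, and membership is up to _≈_.

module _ {c ℓ₁ ℓ₂} (P : Lattice c ℓ₁ ℓ₂) where

  private module P = Lattice P
  open P using (Carrier; _≈_; _≤_; _∨_; _∧_)
  open ToStrict _≈_ _≤_ using (_<_)
  open SetoidMembership P.setoid using (_∈_)

  IsFinite : Set (c ⊔ ℓ₁)
  IsFinite = Σ[ n ∈ ℕ ] Inverse (setoid (Fin n)) P.setoid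

  infix 4 _⋖_

  _⋖_ : Rel Carrier (c ⊔ ℓ₁ ⊔ ℓ₂)
  x ⋖ y = x < y × (∀ z → ¬ (x < z × z < y))

  Interval : Carrier → Carrier → Set (c ⊔ ℓ₂)
  Interval x y = Σ[ z ∈ Carrier ] (x ≤ z × z ≤ y)

  IsBooleanInterval : Carrier → Carrier → Set (c ⊔ ℓ₁ ⊔ ℓ₂)
  IsBooleanInterval x y =
    Σ[ k ∈ ℕ ] Σ[ f ∈ (Interval x y → Subset k) ]
      IsOrderIsomorphism (_≈_ on proj₁) _≡_ (_≤_ on proj₁) _⊆_ f

  -- The fold is x ∨ ⋁ Y, which is ⋁ Y whenever Y is nonempty, since every
  -- element of Y lies above x.  For empty Y the interval is [x , x], which is
  -- boolean, so that case imposes no condition.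
  IsJoinDistributive : Set (c ⊔ ℓ₁ ⊔ ℓ₂)
  IsJoinDistributive =
    ∀ x (Y : List Carrier) → All (x ⋖_) Y → IsBooleanInterval x (foldr _∨_ x Y)

  IsChain : List Carrier → Set (c ⊔ ℓ₁ ⊔ ℓ₂)
  IsChain C = ∀ {x y} → x ∈ C → y ∈ C → x ≤ y ⊎ y ≤ x

  IsMaximalChain : List Carrier → Set (c ⊔ ℓ₁ ⊔ ℓ₂)
  IsMaximalChain C =
    IsChain C ×
    (∀ D → IsChain D → (∀ {x} → x ∈ C → x ∈ D) → (∀ {x} → x ∈ D → x ∈ C))

  data Generated (M C : List Carrier) : Carrier → Set (c ⊔ ℓ₁) where
    genˡ : ∀ {x} → x ∈ M → Generated M C x
    genʳ : ∀ {x} → x ∈ C → Generated M C x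
    join : ∀ {x y} → Generated M C x → Generated M C y → Generated M C (x ∨ y)
    meet : ∀ {x y} → Generated M C x → Generated M C y → Generated M C (x ∧ y)

  GeneratesDistributive : (M C : List Carrier) → Set (c ⊔ ℓ₁)
  GeneratesDistributive M C =
    ∀ {x y z} → Generated M C x → Generated M C y → Generated M C z →
    (x ∧ (y ∨ z)) ≈ ((x ∧ y) ∨ (x ∧ z))

  IsSupersolvable : Set (c ⊔ ℓ₁ ⊔ ℓ₂)
  IsSupersolvable =
    Σ[ M ∈ List Carrier ]
      (IsMaximalChain M × (∀ C → IsMaximalChain C → GeneratesDistributive M C))

  record IsRankFunction (rk : Carrier → ℤ) : Set (c ⊔ ℓ₁ ⊔ ℓ₂) where
    field
      cong  : ∀ {x y} → x ≈ y → rk x ≡ rk y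
      cover : ∀ {x y} → x ⋖ y → rk y ≡ rk x + 1ℤ

  IsGraded : Set (c ⊔ ℓ₁ ⊔ ℓ₂)
  IsGraded = Σ[ rk ∈ (Carrier → ℤ) ] IsRankFunction rk

  AddRelations : List (Carrier × Carrier) → Rel Carrier (c ⊔ ℓ₂)
  AddRelations E = Star (λ x y → x ≤ y ⊎ (x , y) ∈ₚ E)

  IsNewCover : (Carrier → ℤ) → Carrier × Carrier → Set ℓ₂
  IsNewCover rk (x , y) = ¬ (x ≤ y) × rk y ≡ rk x + 1ℤ

  -- When P is finite and rk is a rank function, AddRelations E is a partial
  -- order (each step between distinct elements increases rk), so the negation
  -- of IsLattice asserts precisely that not all joins and meets exist.
  IsMaximalWrt : (Carrier → ℤ) → Set (c ⊔ ℓ₁ ⊔ ℓ₂)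
  IsMaximalWrt rk =
    ∀ (E : List (Carrier × Carrier)) → E ≢ [] → All (IsNewCover rk) E →
    ¬ (∃[ sup ] ∃[ inf ] IsLattice _≈_ (AddRelations E) sup inf)

  -- Maximality is a property of graded lattices, hence the first component.
  -- On a finite lattice a rank function is unique up to an additive
  -- constant, which does not affect IsMaximalWrt, so none is singled out.
  IsMaximal : Set (c ⊔ ℓ₁ ⊔ ℓ₂)
  IsMaximal = IsGraded × (∀ rk → IsRankFunction rk → IsMaximalWrt rk)

{-# OPTIONS --safe #-}

-- Let M be the distinguished maximal chain.  Call m ∈ M a label of x when x ∧ m
-- is below no element of M that is strictly below m.  Labels grow with x, and
-- distributivity along M shows that a cover x ⋖ y adds exactly one label, so
-- the number of labels is a rank function.
--
-- For maximality, choose among the added relations one, x → y, with rk x minimal,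
-- and take the least m ∈ M such that d = y ∧ m is not below x.  Distributivity
-- along M gives x ∧ d ⋖ d, and semimodularity, which comes from the boolean
-- intervals, then gives x ⋖ u for u = x ∨ d.  In the new order y and u both
-- bound x and d from above, whereas d stays not below x by the choice of x.  As
-- y and u lie only one rank above x, the join of x and d can only be
-- y = u ≥ x, contradicting the newness of x → y.

module Submission where

open import Defs
open import Relation.Binary.Lattice.Bundles using (Lattice)

open import Data.Empty using (⊥-elim)
open import Data.Fin.Base using (Fin; zero; suc)
open import Data.Fin.Properties using (any?) renaming (_≟_ to _≟ᶠ_)
import Data.Fin.Subset as Sub
open import Data.Fin.Subset using (Subset; ∣_∣; ⁅_⁆; inside; outside)
import Data.Fin.Subset.Properties as Subₚ
open import Data.Integer.Base as ℤ using (ℤ; +_; 1ℤ)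
import Data.Integer.Properties as ℤₚ
open import Data.List.Base using (List; []; _∷_; foldr; map; allFin)
open import Data.List.Extrema ℤₚ.≤-totalOrder
  using (argmin; argmin-sel; f[argmin]≤f[⊤]; f[argmin]≤f[xs])
open import Data.List.Membership.Propositional using () renaming (_∈_ to _∈ₚ_)
open import Data.List.Membership.Propositional.Properties using (∈-map⁺; ∈-allFin)
import Data.List.Membership.Setoid as SetoidMembership
open import Data.List.Relation.Unary.All as All using (All; []; _∷_)
open import Data.List.Relation.Unary.Any as Any using (Any; here; there)
open import Data.Nat.Base as ℕ using (ℕ)
import Data.Nat.Properties as ℕₚ
open import Data.Nat.Induction using (<-wellFounded)
open import Data.Product.Base using (Σ-syntax; ∃-syntax; _×_; _,_; proj₁; proj₂)
open import Data.Sum.Base as Sum using (_⊎_; inj₁; inj₂)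
open import Data.Vec.Base using (tabulate; _∷_; here; there)
open import Data.Vec.Properties using (lookup∘tabulate; lookup⇒[]=; []=⇒lookup)
open import Function.Base using (_∘_; flip)
open import Function.Bundles using (Inverse)
open import Induction.WellFounded using (Acc; acc)
open import Level using (Level)
open import Relation.Binary.Bundles using (Setoid)
open import Relation.Binary.Core using (Rel)
open import Relation.Binary.Construct.Closure.ReflexiveTransitive using (ε; _◅_; _◅◅_)
open import Relation.Binary.Definitions as B using (Transitive; _Respects₂_)
open import Relation.Binary.Lattice.Structures using (IsLattice)
open import Relation.Binary.Morphism.Structures using (IsOrderIsomorphism)
open import Relation.Binary.PropositionalEquality as ≡ using (_≡_; refl)
open import Relation.Nullary.Decidable as Dec
  using (Dec; yes; no; does; _×-dec_; _⊎-dec_; _→-dec_; ¬?; dec-true)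
open import Relation.Nullary.Negation.Core using (¬_; contradiction)
open import Relation.Unary using (Pred; Decidable; _⊆_)

private
  variable
    a ℓ ℓ′ ℓ″ : Level
    n : ℕ

-- Counting the indices that satisfy a decidable predicate.

∣p∪⁅x⁆∣≡1+∣p∣ : ∀ (s : Subset n) x → x Sub.∉ s → ∣ s Sub.∪ ⁅ x ⁆ ∣ ≡ ℕ.suc ∣ s ∣
∣p∪⁅x⁆∣≡1+∣p∣ (inside  ∷ s) zero    x∉s = contradiction here x∉s
∣p∪⁅x⁆∣≡1+∣p∣ (outside ∷ s) zero    x∉s = ≡.cong (ℕ.suc ∘ ∣_∣) (Subₚ.∪-identityʳ s)
∣p∪⁅x⁆∣≡1+∣p∣ (inside  ∷ s) (suc x) x∉s = ≡.cong ℕ.suc (∣p∪⁅x⁆∣≡1+∣p∣ s x (x∉s ∘ there))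
∣p∪⁅x⁆∣≡1+∣p∣ (outside ∷ s) (suc x) x∉s = ∣p∪⁅x⁆∣≡1+∣p∣ s x (x∉s ∘ there)

⟪_⟫ : {Q : Pred (Fin n) ℓ′} → Decidable Q → Subset n
⟪ Q? ⟫ = tabulate (does ∘ Q?)

module _ {Q : Pred (Fin n) ℓ′} (Q? : Decidable Q) where

  ∈⟪⟫⁺ : ∀ {i} → Q i → i Sub.∈ ⟪ Q? ⟫
  ∈⟪⟫⁺ {i} qi = lookup⇒[]= i _ (≡.trans (lookup∘tabulate _ i) (dec-true (Q? i) qi))

  ∈⟪⟫⁻ : ∀ {i} → i Sub.∈ ⟪ Q? ⟫ → Q i
  ∈⟪⟫⁻ {i} i∈ with Q? i | ≡.trans (≡.sym (lookup∘tabulate (does ∘ Q?) i)) ([]=⇒lookup i∈)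
  ... | yes qi | _ = qi

module _ {Q : Pred (Fin n) ℓ′} {R : Pred (Fin n) ℓ″} (Q? : Decidable Q) (R? : Decidable R) where

  ∣⟪⟫∣-mono : Q ⊆ R → ∣ ⟪ Q? ⟫ ∣ ℕ.≤ ∣ ⟪ R? ⟫ ∣
  ∣⟪⟫∣-mono Q⊆R = Subₚ.p⊆q⇒∣p∣≤∣q∣ (∈⟪⟫⁺ R? ∘ Q⊆R ∘ ∈⟪⟫⁻ Q?)

  ∣⟪⟫∣-strict : Q ⊆ R → ∀ {i} → R i → ¬ Q i → ∣ ⟪ Q? ⟫ ∣ ℕ.< ∣ ⟪ R? ⟫ ∣
  ∣⟪⟫∣-strict Q⊆R {i} ri ¬qi = Subₚ.p⊂q⇒∣p∣<∣q∣
    (∈⟪⟫⁺ R? ∘ Q⊆R ∘ ∈⟪⟫⁻ Q? , i , ∈⟪⟫⁺ R? ri , ¬qi ∘ ∈⟪⟫⁻ Q?)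

  ∣⟪⟫∣-suc : Q ⊆ R → ∀ {i} → R i → ¬ Q i → (∀ {j} → R j → ¬ Q j → j ≡ i) →
             ∣ ⟪ R? ⟫ ∣ ≡ ℕ.suc ∣ ⟪ Q? ⟫ ∣
  ∣⟪⟫∣-suc Q⊆R {i} ri ¬qi unique = ≡.trans
    (≡.cong ∣_∣ (Subₚ.⊆-antisym R⊆Q∪i Q∪i⊆R))
    (∣p∪⁅x⁆∣≡1+∣p∣ _ i (¬qi ∘ ∈⟪⟫⁻ Q?))
    where
    R⊆Q∪i : ⟪ R? ⟫ Sub.⊆ ⟪ Q? ⟫ Sub.∪ ⁅ i ⁆
    R⊆Q∪i {j} j∈ with Q? j
    ... | yes qj = Subₚ.x∈p∪q⁺ (inj₁ (∈⟪⟫⁺ Q? qj))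
    ... | no ¬qj rewrite unique (∈⟪⟫⁻ R? j∈) ¬qj = Subₚ.x∈p∪q⁺ (inj₂ (Subₚ.x∈⁅x⁆ i))

    Q∪i⊆R : ⟪ Q? ⟫ Sub.∪ ⁅ i ⁆ Sub.⊆ ⟪ R? ⟫
    Q∪i⊆R j∈ with Subₚ.x∈p∪q⁻ ⟪ Q? ⟫ ⁅ i ⁆ j∈
    ... | inj₁ j∈Q = ∈⟪⟫⁺ R? (Q⊆R (∈⟪⟫⁻ Q? j∈Q))
    ... | inj₂ j∈i rewrite Subₚ.x∈⁅y⁆⇒x≡y i j∈i = ∈⟪⟫⁺ R? ri

i≡j+1⇒j<i : ∀ {i j} → i ≡ j ℤ.+ 1ℤ → j ℤ.< i
i≡j+1⇒j<i {j = j} refl = ≡.subst (j ℤ.<_) (ℤₚ.+-comm 1ℤ j) (ℤₚ.suc[i]≤j⇒i<j ℤₚ.≤-refl)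

-- Extremal elements of a chain given as a list.

module _ (S : Setoid a ℓ) {r} {_R_ : Rel (Setoid.Carrier S) r} where

  open Setoid S using (Carrier; _≈_; sym) renaming (refl to ≈-refl)
  open SetoidMembership S using (_∈_; find; lose)

  -- Taking `_R_` to be `_≤_` or its converse gives least and greatest elements. Reflexivity on list
  -- members comes from comparing an element with itself by totality.
  extremum : Transitive _R_ → _R_ Respects₂ _≈_ →
             {Q : Pred Carrier ℓ′} → (∀ {x y} → x ≈ y → Q x → Q y) → Decidable Q →
             ∀ xs → (∀ {x y} → x ∈ xs → y ∈ xs → x R y ⊎ y R x) → Any Q xs →
             ∃[ m ] m ∈ xs × Q m × (∀ {y} → y ∈ xs → Q y → m R y)
  extremum R-trans (respʳ , respˡ) {Q} Q-resp Q? (x ∷ xs) total any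
    with Any.any? Q? xs | any
  ... | no ¬any | there any′ = contradiction any′ ¬any
  ... | no ¬any | here qx = x , here ≈-refl , qx , λ where
    (here y≈x) _   → respʳ (sym y≈x) (Sum.reduce (total (here ≈-refl) (here ≈-refl)))
    (there y∈) qy  → contradiction (lose Q-resp y∈ qy) ¬any
  ... | yes any′ | _
    with m , m∈ , qm , m-ext ← extremum R-trans (respʳ , respˡ) Q-resp Q? xs
           (λ x∈ y∈ → total (there x∈) (there y∈)) any′
    with Q? x | total (here ≈-refl) (there m∈)
  ... | no ¬qx | _ = m , there m∈ , qm , λ where
    (here y≈x) qy → contradiction (Q-resp y≈x qy) ¬qx
    (there y∈) qy → m-ext y∈ qy
  ... | yes qx | inj₂ mRx = m , there m∈ , qm , λ where
    (here y≈x) _  → respʳ (sym y≈x) mRx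
    (there y∈) qy → m-ext y∈ qy
  ... | yes qx | inj₁ xRm = x , here ≈-refl , qx , λ where
    (here y≈x) _  → respʳ (sym y≈x) (Sum.reduce (total (here ≈-refl) (here ≈-refl)))
    (there y∈) qy → R-trans xRm (m-ext y∈ qy)

-- Finite lattices: decidability and induction along covers.

module FiniteLattice {c ℓ₁ ℓ₂} (P : Lattice c ℓ₁ ℓ₂) (finite : IsFinite P) where

  open Lattice P public renaming (refl to ≤-refl; trans to ≤-trans; reflexive to ≤-reflexive)
  open import Relation.Binary.Lattice.Properties.JoinSemilattice joinSemilattice public
    using (∨-monotonic; x≤y⇒x∨y≈y)
  open import Relation.Binary.Lattice.Properties.MeetSemilattice meetSemilattice public
    using (∧-monotonic)
  open import Relation.Binary.Construct.NonStrictToStrict _≈_ _≤_ public using (_<_)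
  open SetoidMembership setoid public using (_∈_)

  infix 4 _⋖ₚ_ _≟_ _≤?_

  _⋖ₚ_ : Rel Carrier _
  _⋖ₚ_ = _⋖_ P

  open Inverse (proj₂ finite) using (to; from; from-cong; strictlyInverseˡ)

  index : Carrier → Fin (proj₁ finite)
  index = from

  element : Fin (proj₁ finite) → Carrier
  element = to

  element-index : ∀ x → element (index x) ≈ x
  element-index = strictlyInverseˡ

  element-injective : ∀ {i j} → element i ≈ element j → i ≡ j
  element-injective {i} {j} eq =
    ≡.trans (≡.sym (Inverse.strictlyInverseʳ (proj₂ finite) i))
      (≡.trans (from-cong eq) (Inverse.strictlyInverseʳ (proj₂ finite) j))

  _≟_ : B.Decidable _≈_
  x ≟ y = Dec.map′
    (λ eq → Eq.trans (Eq.sym (element-index x))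
      (Eq.trans (Eq.reflexive (≡.cong to eq)) (element-index y)))
    from-cong (from x ≟ᶠ from y)

  _≤?_ : B.Decidable _≤_
  x ≤? y = Dec.map′ (λ eq → ≤-trans (x≤x∨y x y) (≤-reflexive eq)) x≤y⇒x∨y≈y (x ∨ y ≟ y)

  between? : ∀ x y → Decidable (λ i → x ≤ element i × element i ≤ y)
  between? x y i = (x ≤? element i) ×-dec (element i ≤? y)

  size : Carrier → Carrier → ℕ
  size x y = ∣ ⟪ between? x y ⟫ ∣

  cover⊎between : ∀ {x y} → x < y → x ⋖ₚ y ⊎ (∃[ z ] x < z × z < y)
  cover⊎between {x} {y} x<y@(x≤y , x≉y)
    with any? (λ i → ((x ≤? element i) ×-dec ¬? (x ≟ element i))
                      ×-dec ((element i ≤? y) ×-dec ¬? (element i ≟ y)))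
  ... | yes (i , x<z , z<y) = inj₂ (element i , x<z , z<y)
  ... | no ¬between = inj₁ (x<y , λ z ((x≤z , x≉z) , (z≤y , z≉y)) → ¬between
    ( index z
    , (≤-trans x≤z (≤-reflexive (Eq.sym (element-index z))) , λ eq → x≉z (Eq.trans eq (element-index z)))
    , (≤-trans (≤-reflexive (element-index z)) z≤y , λ eq → z≉y (Eq.trans (Eq.sym (element-index z)) eq))))

  -- An element strictly between `x` and `y` splits the interval into two with fewer elements: the
  -- lower one misses `y` and the upper one misses `x`.
  ≤-induction : (Q : Rel Carrier ℓ′) → (∀ {x y} → x ≈ y → Q x y) → (∀ {x y} → x ⋖ₚ y → Q x y) →
                (∀ {x y z} → y ≤ z → Q x y → Q y z → Q x z) → ∀ {x y} → x ≤ y → Q x y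
  ≤-induction Q Q-refl Q-cover Q-trans x≤y = go x≤y (<-wellFounded _)
    where
    go : ∀ {x y} → x ≤ y → Acc ℕ._<_ (size x y) → Q x y
    go {x} {y} x≤y (acc rec) with x ≟ y
    ... | yes x≈y = Q-refl x≈y
    ... | no  x≉y with cover⊎between (x≤y , x≉y)
    ... | inj₁ x⋖y = Q-cover x⋖y
    ... | inj₂ (z , (x≤z , x≉z) , (z≤y , z≉y)) = Q-trans z≤y
      (go x≤z (rec (∣⟪⟫∣-strict (between? x z) (between? x y)
        (λ (x≤i , i≤z) → x≤i , ≤-trans i≤z z≤y)
        (≤-trans x≤y (≤-reflexive (Eq.sym (element-index y))) , ≤-reflexive (element-index y))
        (λ (_ , y≤z) → z≉y (antisym z≤y (≤-trans (≤-reflexive (Eq.sym (element-index y))) y≤z))))))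
      (go z≤y (rec (∣⟪⟫∣-strict (between? z y) (between? x y)
        (λ (z≤i , i≤y) → ≤-trans x≤z z≤i , i≤y)
        (≤-reflexive (Eq.sym (element-index x)) , ≤-trans (≤-reflexive (element-index x)) x≤y)
        (λ (z≤x , _) → x≉z (antisym x≤z (≤-trans z≤x (≤-reflexive (element-index x))))))))

  -- Chains and their extension to maximal chains.

  Comparable : Carrier → Carrier → Set ℓ₂
  Comparable x y = x ≤ y ⊎ y ≤ x

  comparable-resp : ∀ {x x′ y y′} → x ≈ x′ → y ≈ y′ → Comparable x y → Comparable x′ y′
  comparable-resp x≈x′ y≈y′ = Sum.map
    (λ x≤y → ≤-trans (≤-reflexive (Eq.sym x≈x′)) (≤-trans x≤y (≤-reflexive y≈y′)))
    (λ y≤x → ≤-trans (≤-reflexive (Eq.sym y≈y′)) (≤-trans y≤x (≤-reflexive x≈x′)))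

  chain-∷ : ∀ {C} z → IsChain P C → (∀ {x} → x ∈ C → Comparable z x) → IsChain P (z ∷ C)
  chain-∷ z chain comp (here x≈z) (here y≈z) = inj₁ (≤-reflexive (Eq.trans x≈z (Eq.sym y≈z)))
  chain-∷ z chain comp (here x≈z) (there y∈) = comparable-resp (Eq.sym x≈z) Eq.refl (comp y∈)
  chain-∷ z chain comp (there x∈) (here y≈z) = Sum.swap (comparable-resp (Eq.sym y≈z) Eq.refl (comp x∈))
  chain-∷ z chain comp (there x∈) (there y∈) = chain x∈ y∈

  comparable⇒∈ : ∀ {C} → IsMaximalChain P C → ∀ {z} → (∀ {x} → x ∈ C → Comparable z x) → z ∈ C
  comparable⇒∈ {C} (chain , maximal) {z} comp =
    maximal (z ∷ C) (chain-∷ z chain comp) there (here Eq.refl)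

  allComparable? : ∀ C z → Dec (∀ {x} → x ∈ C → Comparable z x)
  allComparable? C z = Dec.map′
    (λ all {x} x∈ → All.lookupₛ setoid (λ eq → comparable-resp Eq.refl eq) all x∈)
    (λ comp → All.tabulate (λ x∈ → comp (Any.map Eq.reflexive x∈)))
    (All.all? (λ x → (z ≤? x) ⊎-dec (x ≤? z)) C)

  insert : Carrier → List Carrier → List Carrier
  insert z C with allComparable? C z
  ... | yes _ = z ∷ C
  ... | no  _ = C

  insert-chain : ∀ z {C} → IsChain P C → IsChain P (insert z C)
  insert-chain z {C} chain with allComparable? C z
  ... | yes comp = chain-∷ z chain comp
  ... | no  _    = chain

  insert-⊇ : ∀ z {C x} → x ∈ C → x ∈ insert z C
  insert-⊇ z {C} x∈ with allComparable? C z
  ... | yes _ = there x∈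
  ... | no  _ = x∈

  insert-∈ : ∀ z {C} → (∀ {x} → x ∈ C → Comparable z x) → z ∈ insert z C
  insert-∈ z {C} comp with allComparable? C z
  ... | yes _     = here Eq.refl
  ... | no  ¬comp = ⊥-elim (¬comp comp)

  saturate : List Carrier → List Carrier → List Carrier
  saturate = foldr insert

  saturate-chain : ∀ {C} L → IsChain P C → IsChain P (saturate C L)
  saturate-chain []      chain = chain
  saturate-chain (z ∷ L) chain = insert-chain z (saturate-chain L chain)

  saturate-⊇ : ∀ {C} L {x} → x ∈ C → x ∈ saturate C L
  saturate-⊇ []      x∈ = x∈
  saturate-⊇ (z ∷ L) x∈ = insert-⊇ z (saturate-⊇ L x∈)

  -- The chain grows greedily, each element of `L` being tried once. What is comparable to the final
  -- chain is comparable to the smaller chain present at its trial, so it was inserted then.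
  saturate-maximal : ∀ {C} L {z} → z ∈ₚ L → (∀ {x} → x ∈ saturate C L → Comparable z x) →
                     z ∈ saturate C L
  saturate-maximal (w ∷ L) (here refl) comp = insert-∈ w {saturate _ L} (comp ∘ insert-⊇ w)
  saturate-maximal (w ∷ L) (there z∈)  comp =
    insert-⊇ w (saturate-maximal L z∈ (comp ∘ insert-⊇ w))

  extendChain : ∀ {C} → IsChain P C →
                Σ[ D ∈ List Carrier ] IsMaximalChain P D × (∀ {x} → x ∈ C → x ∈ D)
  extendChain {C} chain = D , (saturate-chain elements chain , maximal) , saturate-⊇ elements
    where
    elements : List Carrier
    elements = map element (allFin _)

    D : List Carrier
    D = saturate C elements

    maximal : ∀ D′ → IsChain P D′ → (∀ {x} → x ∈ D → x ∈ D′) → ∀ {x} → x ∈ D′ → x ∈ D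
    maximal D′ chain′ D⊆D′ {x} x∈D′ = Any.map (Eq.trans (Eq.sym (element-index x)))
      (saturate-maximal elements (∈-map⁺ element (∈-allFin (index x))) λ y∈ →
        comparable-resp (Eq.sym (element-index x)) Eq.refl (chain′ x∈D′ (D⊆D′ y∈)))

  -- Bounds of lists, covers and boolean intervals.

  ⋁-upper : ∀ x L {y} → y ∈ x ∷ L → y ≤ foldr _∨_ x L
  ⋁-upper x []      (here y≈x)          = ≤-reflexive y≈x
  ⋁-upper x (z ∷ L) (here y≈x)          = ≤-trans (⋁-upper x L (here y≈x)) (y≤x∨y _ _)
  ⋁-upper x (z ∷ L) (there (here y≈z))  = ≤-trans (≤-reflexive y≈z) (x≤x∨y _ _)
  ⋁-upper x (z ∷ L) (there (there y∈))  = ≤-trans (⋁-upper x L (there y∈)) (y≤x∨y _ _)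

  ⋀-lower : ∀ x L {y} → y ∈ x ∷ L → foldr _∧_ x L ≤ y
  ⋀-lower x []      (here y≈x)          = ≤-reflexive (Eq.sym y≈x)
  ⋀-lower x (z ∷ L) (here y≈x)          = ≤-trans (x∧y≤y _ _) (⋀-lower x L (here y≈x))
  ⋀-lower x (z ∷ L) (there (here y≈z))  = ≤-trans (x∧y≤x _ _) (≤-reflexive (Eq.sym y≈z))
  ⋀-lower x (z ∷ L) (there (there y∈))  = ≤-trans (x∧y≤y _ _) (⋀-lower x L (there y∈))

  ⋖-respˡ : ∀ {x x′ y} → x ≈ x′ → x ⋖ₚ y → x′ ⋖ₚ y
  ⋖-respˡ x≈x′ ((x≤y , x≉y) , ¬between) =
    (≤-trans (≤-reflexive (Eq.sym x≈x′)) x≤y , x≉y ∘ Eq.trans x≈x′) ,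
    λ z ((x′≤z , x′≉z) , z<y) → ¬between z
      ((≤-trans (≤-reflexive x≈x′) x′≤z , x′≉z ∘ Eq.trans (Eq.sym x≈x′)) , z<y)

  ⋖-respʳ : ∀ {x y y′} → y ≈ y′ → x ⋖ₚ y → x ⋖ₚ y′
  ⋖-respʳ y≈y′ ((x≤y , x≉y) , ¬between) =
    (≤-trans x≤y (≤-reflexive y≈y′) , x≉y ∘ flip Eq.trans (Eq.sym y≈y′)) ,
    λ z (x<z , (z≤y′ , z≉y′)) → ¬between z
      (x<z , (≤-trans z≤y′ (≤-reflexive (Eq.sym y≈y′)) , z≉y′ ∘ flip Eq.trans y≈y′))

  ⋖-between : ∀ {x y z} → x ⋖ₚ y → x ≤ z → z ≤ y → x ≈ z ⊎ z ≈ y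
  ⋖-between {x} {y} {z} (_ , ¬between) x≤z z≤y with x ≟ z | z ≟ y
  ... | yes x≈z | _       = inj₁ x≈z
  ... | no  _   | yes z≈y = inj₂ z≈y
  ... | no  x≉z | no  z≉y = contradiction ((x≤z , x≉z) , (z≤y , z≉y)) (¬between z)

  -- Distributivity is pulled back from subsets. As `f` is only known to be an order isomorphism,
  -- its values on joins and meets are bounded through preimages of unions and intersections.
  boolean⇒distributive : ∀ {x y} → IsBooleanInterval P x y → ∀ {u v w} →
    x ≤ u → u ≤ y → x ≤ v → v ≤ y → x ≤ w → w ≤ y → u ∧ (v ∨ w) ≤ (u ∧ v) ∨ (u ∧ w)
  boolean⇒distributive {x} {y} (k , f , iso) {u} {v} {w} x≤u u≤y x≤v v≤y x≤w w≤y =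
    cancel {lhs} {rhs} f-lhs⊆f-rhs
    where
    open IsOrderIsomorphism iso using (mono; cancel; surjective)
    U V W lhs rhs U∧V U∧W V∨W : Interval P x y
    U = u , x≤u , u≤y
    V = v , x≤v , v≤y
    W = w , x≤w , w≤y
    U∧V = u ∧ v , ∧-greatest x≤u x≤v , ≤-trans (x∧y≤x _ _) u≤y
    U∧W = u ∧ w , ∧-greatest x≤u x≤w , ≤-trans (x∧y≤x _ _) u≤y
    V∨W = v ∨ w , ≤-trans x≤v (x≤x∨y _ _) , ∨-least v≤y w≤y
    lhs = u ∧ (v ∨ w) , ∧-greatest x≤u (proj₁ (proj₂ V∨W)) , ≤-trans (x∧y≤x _ _) u≤y
    rhs = (u ∧ v) ∨ (u ∧ w) , ≤-trans (proj₁ (proj₂ U∧V)) (x≤x∨y _ _) ,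
          ∨-least (proj₂ (proj₂ U∧V)) (proj₂ (proj₂ U∧W))

    preimage : ∀ s → Σ[ Z ∈ Interval P x y ] f Z ≡ s
    preimage s with Z , eq ← surjective s = Z , eq Eq.refl

    f-∨ : f V∨W Sub.⊆ f V Sub.∪ f W
    f-∨ with Z , refl-eq ← preimage (f V Sub.∪ f W) = λ i∈ → ≡.subst (_ Sub.∈_) refl-eq
      (mono {V∨W} {Z} (∨-least
        (cancel {V} {Z} (≡.subst (f V Sub.⊆_) (≡.sym refl-eq) (Subₚ.p⊆p∪q (f W))))
        (cancel {W} {Z} (≡.subst (f W Sub.⊆_) (≡.sym refl-eq) (Subₚ.q⊆p∪q (f V) (f W))))) i∈)

    -- The equation admits any interval element over the meet, whatever its bound proofs, so one
    -- proof serves both `U∧V` and `U∧W`.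
    f-∧ : ∀ Z (U∧Z : Interval P x y) → proj₁ U∧Z ≡ u ∧ proj₁ Z → f U Sub.∩ f Z Sub.⊆ f U∧Z
    f-∧ Z U∧Z refl with T , eq ← preimage (f U Sub.∩ f Z) = λ i∈ →
      mono {T} {U∧Z} (∧-greatest
        (cancel {T} {U} (≡.subst (Sub._⊆ f U) (≡.sym eq) (Subₚ.p∩q⊆p (f U) (f Z))))
        (cancel {T} {Z} (≡.subst (Sub._⊆ f Z) (≡.sym eq) (Subₚ.p∩q⊆q (f U) (f Z)))))
        (≡.subst (_ Sub.∈_) (≡.sym eq) i∈)

    f-lhs⊆f-rhs : f lhs Sub.⊆ f rhs
    f-lhs⊆f-rhs i∈ with Subₚ.x∈p∪q⁻ (f V) (f W) (f-∨ (mono {lhs} {V∨W} (x∧y≤y _ _) i∈))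
    ... | inj₁ i∈V = mono {U∧V} {rhs} (x≤x∨y _ _)
      (f-∧ V U∧V refl (Subₚ.x∈p∩q⁺ (mono {lhs} {U} (x∧y≤x _ _) i∈ , i∈V)))
    ... | inj₂ i∈W = mono {U∧W} {rhs} (y≤x∨y _ _)
      (f-∧ W U∧W refl (Subₚ.x∈p∩q⁺ (mono {lhs} {U} (x∧y≤x _ _) i∈ , i∈W)))

  -- Semimodularity from boolean intervals.

  module JoinDistributive (jd : IsJoinDistributive P) where

    -- For `w` between `y` and `y ∨ z`, the meet `w ∧ z` is `z` or `x`, as `x ⋖ z`. If it is `z`,
    -- then `w` is `y ∨ z`. If it is `x`, distributivity gives `w ≤ (w ∧ y) ∨ (w ∧ z) ≤ y`.
    localSemimodular : ∀ {x y z} → x ⋖ₚ y → x ⋖ₚ z → ¬ z ≤ y → y ⋖ₚ y ∨ z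
    localSemimodular {x} {y} {z} x⋖y@((x≤y , _) , _) x⋖z@((x≤z , _) , _) z≰y =
      (x≤x∨y y z , λ eq → z≰y (≤-trans (y≤x∨y y z) (≤-reflexive (Eq.sym eq)))) , ¬between
      where
      top : Carrier
      -- This is the fold that `jd` produces for the list `y ∷ z ∷ []`.
      top = y ∨ (z ∨ x)

      ∨≤top : y ∨ z ≤ top
      ∨≤top = ∨-monotonic ≤-refl (x≤x∨y z x)

      ¬between : ∀ w → ¬ (y < w × w < y ∨ z)
      ¬between w ((y≤w , y≉w) , (w≤y∨z , w≉y∨z))
        with ⋖-between x⋖z (∧-greatest (≤-trans x≤y y≤w) x≤z) (x∧y≤y w z)
      ... | inj₂ w∧z≈z = w≉y∨z (antisym w≤y∨z
        (∨-least y≤w (≤-trans (≤-reflexive (Eq.sym w∧z≈z)) (x∧y≤x w z))))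
      ... | inj₁ x≈w∧z = y≉w (antisym y≤w (≤-trans (∧-greatest ≤-refl w≤y∨z)
        (≤-trans
          (boolean⇒distributive (jd x (y ∷ z ∷ []) (x⋖y ∷ x⋖z ∷ []))
            (≤-trans x≤y y≤w) (≤-trans w≤y∨z ∨≤top)
            x≤y (x≤x∨y _ _) x≤z (≤-trans (y≤x∨y y z) ∨≤top))
          (∨-least (x∧y≤y w y) (≤-trans (≤-reflexive (Eq.sym x≈w∧z)) x≤y)))))

    -- The cover `x ⋖ z` is carried upwards along covers from `x` to `y`. Since `z` is not below
    -- `y`, it is below no element passed on the way, so `localSemimodular` applies each time.
    semimodular : ∀ {x y} → x ≤ y → ∀ {z} → x ⋖ₚ z → ¬ z ≤ y → y ⋖ₚ y ∨ z
    semimodular = ≤-induction Q Q-refl (λ x⋖y {_} → localSemimodular x⋖y) Q-trans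
      where
      Q : Rel Carrier _
      Q x y = ∀ {z} → x ⋖ₚ z → ¬ z ≤ y → y ⋖ₚ y ∨ z

      Q-refl : ∀ {x y} → x ≈ y → Q x y
      Q-refl x≈y x⋖z@((x≤z , _) , _) _ = ⋖-respˡ x≈y (⋖-respʳ
        (antisym (y≤x∨y _ _) (∨-least (≤-trans (≤-reflexive (Eq.sym x≈y)) x≤z) ≤-refl)) x⋖z)

      Q-trans : ∀ {x y z} → y ≤ z → Q x y → Q y z → Q x z
      Q-trans y≤z Qxy Qyz {w} x⋖w w≰z = ⋖-respʳ
        (antisym (∨-least (x≤x∨y _ _) (∨-monotonic y≤z ≤-refl)) (∨-monotonic ≤-refl (y≤x∨y _ _)))
        (Qyz (Qxy x⋖w (λ w≤y → w≰z (≤-trans w≤y y≤z))) (λ le → w≰z (≤-trans (y≤x∨y _ _) le)))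

  -- Ranks and the order with added relations.

  module RankFunction {rk : Carrier → ℤ} (isRank : IsRankFunction P rk) where

    open IsRankFunction isRank

    ≈⊎<-trans : Transitive (λ x y → x ≈ y ⊎ rk x ℤ.< rk y)
    ≈⊎<-trans (inj₁ x≈y) (inj₁ y≈z) = inj₁ (Eq.trans x≈y y≈z)
    ≈⊎<-trans (inj₁ x≈y) (inj₂ y<z) = inj₂ (ℤₚ.≤-<-trans (ℤₚ.≤-reflexive (cong x≈y)) y<z)
    ≈⊎<-trans (inj₂ x<y) (inj₁ y≈z) = inj₂ (ℤₚ.<-≤-trans x<y (ℤₚ.≤-reflexive (cong y≈z)))
    ≈⊎<-trans (inj₂ x<y) (inj₂ y<z) = inj₂ (ℤₚ.<-trans x<y y<z)

    ≈⊎<⇒≤ : ∀ {x y} → x ≈ y ⊎ rk x ℤ.< rk y → rk x ℤ.≤ rk y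
    ≈⊎<⇒≤ (inj₁ x≈y) = ℤₚ.≤-reflexive (cong x≈y)
    ≈⊎<⇒≤ (inj₂ x<y) = ℤₚ.<⇒≤ x<y

    rank-strict : ∀ {x y} → x ≤ y → x ≈ y ⊎ rk x ℤ.< rk y
    rank-strict = ≤-induction (λ x y → x ≈ y ⊎ rk x ℤ.< rk y) inj₁
      (λ x⋖y → inj₂ (i≡j+1⇒j<i (cover x⋖y))) (λ _ → ≈⊎<-trans)

    module _ {E : List (Carrier × Carrier)} (new : All (IsNewCover P rk) E) where

      added-strict : ∀ {x y} → AddRelations P E x y → x ≈ y ⊎ rk x ℤ.< rk y
      added-strict ε               = inj₁ Eq.refl
      added-strict (inj₁ x≤z ◅ zy) = ≈⊎<-trans (rank-strict x≤z) (added-strict zy)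
      added-strict (inj₂ e∈E ◅ zy) =
        ≈⊎<-trans (inj₂ (i≡j+1⇒j<i (proj₂ (All.lookup new e∈E)))) (added-strict zy)

      -- A path without added pairs stays in `_≤_`. Otherwise its first added pair starts at rank at
      -- least `r` and ends above `r`, and the rank never drops afterwards. Hence nothing new
      -- appears below elements of rank at most `r`.
      added⇒≤⊎aboveLowest : ∀ {r} → All (λ e → r ℤ.≤ rk (proj₁ e)) E →
                            ∀ {x y} → AddRelations P E x y → x ≤ y ⊎ r ℤ.< rk y
      added⇒≤⊎aboveLowest low ε               = inj₁ ≤-refl
      added⇒≤⊎aboveLowest low (inj₁ x≤z ◅ zy) =
        Sum.map₁ (≤-trans x≤z) (added⇒≤⊎aboveLowest low zy)
      added⇒≤⊎aboveLowest low (inj₂ e∈E ◅ zy) = inj₂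
        (ℤₚ.≤-<-trans (All.lookup low e∈E)
          (ℤₚ.<-≤-trans (i≡j+1⇒j<i (proj₂ (All.lookup new e∈E))) (≈⊎<⇒≤ (added-strict zy))))

  -- The distinguished chain: critical steps and labels.

  module Supersolvable (M : List Carrier) (M-max : IsMaximalChain P M)
    (distributive : ∀ C → IsMaximalChain P C → GeneratesDistributive P M C) where

    M-chain : IsChain P M
    M-chain = proj₁ M-max

    -- The two-element chain extends to a maximal one, to which supersolvability applies.
    chainDistributive : ∀ {x y} → x ≤ y → Σ[ C ∈ List Carrier ] x ∈ C × y ∈ C ×
      (∀ {u v w} → Generated P M C u → Generated P M C v → Generated P M C w →
       u ∧ (v ∨ w) ≤ (u ∧ v) ∨ (u ∧ w))
    chainDistributive {x} {y} x≤y
      with C , C-max , ⊆C ← extendChain {x ∷ y ∷ []} (chain-∷ x (chain-∷ {[]} y (λ ()) (λ ()))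
        λ { (here z≈y) → inj₁ (≤-trans x≤y (≤-reflexive (Eq.sym z≈y))) ; (there ()) })
      = C , ⊆C (here Eq.refl) , ⊆C (there (here Eq.refl)) ,
        λ u v w → ≤-reflexive (distributive C C-max u v w)

    -- Here `p` and `m` are consecutive in `M`: moving up `M`, the meet with `y` stops being below
    -- `x` exactly between them. The field `covers` expresses `p ⋖ m` in a form ready for case
    -- analysis.
    record CriticalStep (x y : Carrier) : Set (c Level.⊔ ℓ₁ Level.⊔ ℓ₂) where
      field
        {p m}  : Carrier
        p∈M    : p ∈ M
        m∈M    : m ∈ M
        p≤m    : p ≤ m
        y∧p≤x  : y ∧ p ≤ x
        y∧m≰x  : ¬ y ∧ m ≤ x
        split  : ∀ {z} → z ∈ M → z ≤ p ⊎ m ≤ z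
        covers : ∀ {z} → p ≤ z → z ≤ m → z ≤ p ⊎ m ≤ z

    criticalStep : ∀ {x y} → ¬ y ≤ x → CriticalStep x y
    criticalStep {x} {y} y≰x
      with m , m∈M , y∧m≰x , m-least ← extremum setoid ≤-trans ≤-resp-≈
             (λ z≈w y∧z≰x y∧w≤x → y∧z≰x (≤-trans (∧-monotonic ≤-refl (≤-reflexive z≈w)) y∧w≤x))
             (λ z → ¬? (y ∧ z ≤? x)) M M-chain
             -- The join of `y` with all of `M` lies above `M`, hence in `M` by maximality, and its
             -- meet with `y` is `y`. So a candidate for `m` exists.
             (Any.map (λ ⊤≈z y∧z≤x → y≰x (≤-trans
                 (∧-greatest ≤-refl (≤-trans (⋁-upper y M (here Eq.refl)) (≤-reflexive ⊤≈z))) y∧z≤x))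
               (comparable⇒∈ M-max (inj₂ ∘ ⋁-upper y M ∘ there)))
      with p , p∈M , y∧p≤x , p-greatest ← extremum setoid (flip ≤-trans)
             (proj₂ ≤-resp-≈ , proj₁ ≤-resp-≈)
             (λ z≈w → ≤-trans (∧-monotonic ≤-refl (≤-reflexive (Eq.sym z≈w))))
             (λ z → y ∧ z ≤? x) M (λ u v → Sum.swap (M-chain u v))
             -- Dually, the meet of `x` with all of `M` belongs to `M` and lies below `x`, so a
             -- candidate for `p` exists.
             (Any.map (λ ⊥≈z → ≤-trans (x∧y≤y _ _)
                 (≤-trans (≤-reflexive (Eq.sym ⊥≈z)) (⋀-lower x M (here Eq.refl))))
               (comparable⇒∈ M-max (inj₁ ∘ ⋀-lower x M ∘ there)))
      = record
        { p∈M = p∈M ; m∈M = m∈M ; p≤m = p≤m ; y∧p≤x = y∧p≤x ; y∧m≰x = y∧m≰x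
        ; split = split
        -- An element between `p` and `m` is comparable to all of `M`, so maximality puts it in `M`,
        -- where `split` decides.
        ; covers = λ p≤z z≤m → split (comparable⇒∈ M-max (λ w∈M →
            Sum.[ (λ w≤p → inj₂ (≤-trans w≤p p≤z)) , (λ m≤w → inj₁ (≤-trans z≤m m≤w)) ] (split w∈M)))
        }
      where
      split : ∀ {z} → z ∈ M → z ≤ p ⊎ m ≤ z
      split {z} z∈M with y ∧ z ≤? x
      ... | yes y∧z≤x = inj₁ (p-greatest z∈M y∧z≤x)
      ... | no  y∧z≰x = inj₂ (m-least z∈M y∧z≰x)

      p≤m : p ≤ m
      p≤m with M-chain p∈M m∈M
      ... | inj₁ p≤m = p≤m
      ... | inj₂ m≤p = contradiction (≤-trans (∧-monotonic ≤-refl m≤p) y∧p≤x) y∧m≰x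

    module _ {x y : Carrier} (step : CriticalStep x y) where

      open CriticalStep step

      -- Let `z` lie between `x ∧ c` and `c = y ∧ m`. Then `p ∨ z` is `p` or `m`. If `p`, then
      -- `z ≤ y ∧ p ≤ x`. If `m`, distributivity gives `c ≤ (c ∧ p) ∨ (c ∧ z) ≤ z`, because
      -- `c ∧ p ≤ x ∧ c`. The chain used runs through `z` and `c`, so `x` and `y` may be
      -- incomparable, as they are for an added pair.
      critical-⋖ : x ∧ (y ∧ m) ⋖ₚ y ∧ m
      critical-⋖ =
        (x∧y≤y _ _ , λ eq → y∧m≰x (≤-trans (≤-reflexive (Eq.sym eq)) (x∧y≤x _ _))) , ¬between
        where
        ¬between : ∀ z → ¬ (x ∧ (y ∧ m) < z × z < y ∧ m)
        ¬between z ((x∧c≤z , x∧c≉z) , (z≤c , z≉c))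
          with covers {p ∨ z} (x≤x∨y p z) (∨-least p≤m (≤-trans z≤c (x∧y≤y y m)))
        ... | inj₁ p∨z≤p = x∧c≉z (antisym x∧c≤z (∧-greatest
          (≤-trans (∧-greatest (≤-trans z≤c (x∧y≤x y m)) (≤-trans (y≤x∨y p z) p∨z≤p)) y∧p≤x) z≤c))
        ... | inj₂ m≤p∨z with C , z∈C , c∈C , dist ← chainDistributive z≤c =
          z≉c (antisym z≤c (≤-trans (∧-greatest ≤-refl (≤-trans (x∧y≤y y m) m≤p∨z))
            (≤-trans (dist (genʳ c∈C) (genˡ p∈M) (genʳ z∈C))
              (∨-least
                (≤-trans (∧-greatest
                  (≤-trans (∧-monotonic (x∧y≤x y m) ≤-refl) y∧p≤x) (x∧y≤x _ _)) x∧c≤z)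
                (x∧y≤y _ _)))))

    -- In other words, `m` is the least element of `M` above `x ∧ m`. The bottom is a label of every
    -- element, which shifts the count by one throughout. The label gained along a cover `x ⋖ y` is
    -- the least `m` in `M` with `y ≤ x ∨ m`, its usual edge label in a supersolvable lattice.
    Label : Carrier → Pred Carrier _
    Label x m = m ∈ M × (∀ {p} → p ∈ M → x ∧ m ≤ p → m ≤ p)

    label? : ∀ x → Decidable (Label x)
    label? x m = Any.any? (m ≟_) M ×-dec Dec.map′
      (λ all {p} → All.lookupₛ setoid (λ p≈q f x∧m≤q →
        ≤-trans (f (≤-trans x∧m≤q (≤-reflexive (Eq.sym p≈q)))) (≤-reflexive p≈q)) all)
      (λ f → All.tabulate (λ p∈ → f (Any.map Eq.reflexive p∈)))
      (All.all? (λ p → (x ∧ m ≤? p) →-dec (m ≤? p)) M)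

    label-resp : ∀ {x m m′} → m ≈ m′ → Label x m → Label x m′
    label-resp m≈m′ (m∈M , f) = Any.map (Eq.trans (Eq.sym m≈m′)) m∈M , λ p∈M x∧m′≤p →
      ≤-trans (≤-reflexive (Eq.sym m≈m′))
        (f p∈M (≤-trans (∧-monotonic ≤-refl (≤-reflexive m≈m′)) x∧m′≤p))

    label-mono : ∀ {x y} → x ≤ y → ∀ {m} → Label x m → Label y m
    label-mono x≤y (m∈M , f) = m∈M , λ p∈M y∧m≤p → f p∈M (≤-trans (∧-monotonic x≤y ≤-refl) y∧m≤p)

    module _ {x y : Carrier} (step : CriticalStep x y) where

      open CriticalStep step

      critical-label : Label y m
      critical-label = m∈M , λ q∈M y∧m≤q → Sum.[
        (λ q≤p → contradiction
          (≤-trans (∧-greatest (x∧y≤x _ _) (≤-trans y∧m≤q q≤p)) y∧p≤x) y∧m≰x) ,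
        (λ m≤q → m≤q) ] (split q∈M)

      -- The element `p ∨ (x ∧ m)` is `p` or `m`. In the first case a label `m` of `x` would force
      -- `m ≤ p`. In the second, distributivity gives `y ∧ m ≤ (y ∧ p) ∨ (y ∧ (x ∧ m)) ≤ x`. Both
      -- contradict `y∧m≰x`.
      critical-¬label : x ≤ y → ¬ Label x m
      critical-¬label x≤y (_ , label) with covers {p ∨ (x ∧ m)} (x≤x∨y _ _) (∨-least p≤m (x∧y≤y _ _))
      ... | inj₁ ≤p = y∧m≰x (≤-trans
        (∧-monotonic ≤-refl (label p∈M (≤-trans (y≤x∨y _ _) ≤p))) y∧p≤x)
      ... | inj₂ m≤ with C , x∈C , y∈C , dist ← chainDistributive x≤y =
        y∧m≰x (≤-trans (∧-monotonic ≤-refl m≤)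
          (≤-trans (dist (genʳ y∈C) (genˡ p∈M) (meet (genʳ x∈C) (genˡ m∈M)))
            (∨-least y∧p≤x (≤-trans (x∧y≤y _ _) (x∧y≤x _ _)))))

    -- Used in both directions, this makes the new label unique. As `m` is new, `y ∧ m` is not below
    -- `x`, so `x ∨ (y ∧ m)` is `y`. Distributivity then bounds `y ∧ k` by `(x ∧ k) ∨ m`, and if
    -- `k ≤ m` failed, `k` would already be a label of `x`.
    newLabel-≤ : ∀ {x y} → x ⋖ₚ y → ∀ {k m} → Label y k → ¬ Label x k → Label y m → ¬ Label x m →
                 k ≤ m
    newLabel-≤ {x} {y} x⋖y@((x≤y , _) , _) {k} {m} (k∈M , k-label) ¬xk (m∈M , m-label) ¬xm
      with k ≤? m
    ... | yes k≤m = k≤m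
    ... | no  k≰m = ⊥-elim (¬xk (k∈M , λ {q} q∈M x∧k≤q →
      -- If `q ≤ m`, then `x ∧ k ≤ m`, and `k≤` applied to `m` itself yields `k ≤ m`.
      Sum.[ (λ q≤m → contradiction (k≤ m∈M (≤-trans x∧k≤q q≤m) ≤-refl) k≰m)
          , k≤ q∈M x∧k≤q ] (M-chain q∈M m∈M)))
      where
      x≉x∨y∧m : ¬ x ≈ x ∨ (y ∧ m)
      x≉x∨y∧m eq = ¬xm (m∈M , λ q∈M x∧m≤q → m-label q∈M
        (≤-trans (∧-greatest (≤-trans (y≤x∨y _ _) (≤-reflexive (Eq.sym eq))) (x∧y≤y _ _)) x∧m≤q))

      y≤x∨y∧m : y ≤ x ∨ (y ∧ m)
      y≤x∨y∧m with ⋖-between x⋖y (x≤x∨y x (y ∧ m)) (∨-least x≤y (x∧y≤x y m))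
      ... | inj₁ eq = contradiction eq x≉x∨y∧m
      ... | inj₂ eq = ≤-reflexive (Eq.sym eq)

      k≤ : ∀ {q} → q ∈ M → x ∧ k ≤ q → m ≤ q → k ≤ q
      k≤ q∈M x∧k≤q m≤q with C , x∈C , y∈C , dist ← chainDistributive x≤y =
        k-label q∈M (≤-trans (∧-greatest (x∧y≤y y k) (≤-trans (x∧y≤x y k) y≤x∨y∧m))
          (≤-trans (dist (genˡ k∈M) (genʳ x∈C) (meet (genʳ y∈C) (genˡ m∈M)))
            (∨-least (≤-trans (∧-greatest (x∧y≤y _ _) (x∧y≤x _ _)) x∧k≤q)
                     (≤-trans (≤-trans (x∧y≤y _ _) (x∧y≤y _ _)) m≤q))))

    -- The number of labels as a rank function.

    label?ᶠ : ∀ x → Decidable (Label x ∘ element)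
    label?ᶠ x i = label? x (element i)

    -- Counting over indices makes elements equal up to `_≈_` count once.
    rank : Carrier → ℤ
    rank x = + ∣ ⟪ label?ᶠ x ⟫ ∣

    rank-isRank : IsRankFunction P rank
    rank-isRank = record
      { cong  = λ x≈y → ≡.cong +_ (ℕₚ.≤-antisym
          (∣⟪⟫∣-mono (label?ᶠ _) (label?ᶠ _) (label-mono (≤-reflexive x≈y)))
          (∣⟪⟫∣-mono (label?ᶠ _) (label?ᶠ _) (label-mono (≤-reflexive (Eq.sym x≈y)))))
      ; cover = rank-cover
      }
      where
      rank-cover : ∀ {x y} → x ⋖ₚ y → rank y ≡ rank x ℤ.+ 1ℤ
      rank-cover {x} {y} x⋖y@((x≤y , x≉y) , _) = ≡.cong +_ (≡.trans
        (∣⟪⟫∣-suc (label?ᶠ x) (label?ᶠ y) (label-mono x≤y) ym ¬xm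
          (λ yj ¬xj → element-injective
            (antisym (newLabel-≤ x⋖y yj ¬xj ym ¬xm) (newLabel-≤ x⋖y ym ¬xm yj ¬xj))))
        (ℕₚ.+-comm 1 _))
        where
        step : CriticalStep x y
        step = criticalStep (λ y≤x → x≉y (antisym x≤y y≤x))

        m≈ : CriticalStep.m step ≈ element (index (CriticalStep.m step))
        m≈ = Eq.sym (element-index _)

        ym : Label y (element (index (CriticalStep.m step)))
        ym = label-resp m≈ (critical-label step)

        ¬xm : ¬ Label x (element (index (CriticalStep.m step)))
        ¬xm = critical-¬label step x≤y ∘ label-resp (Eq.sym m≈)

    -- Maximality.

    module _ (jd : IsJoinDistributive P) {rk : Carrier → ℤ} (isRank : IsRankFunction P rk) where

      open JoinDistributive jd
      open RankFunction isRank
      open IsRankFunction isRank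

      lowest-¬lattice : ∀ {E x y} → All (IsNewCover P rk) E → (x , y) ∈ₚ E →
                        All (λ e → rk x ℤ.≤ rk (proj₁ e)) E →
                        ¬ (∃[ sup ] ∃[ inf ] IsLattice _≈_ (AddRelations P E) sup inf)
      lowest-¬lattice {E} {x} {y} new xy∈E low (sup , inf , isLattice) =
        x≰y (≤-trans (x≤x∨y x d) (≤-reflexive (Eq.trans (Eq.sym s≈u) s≈y)))
        where
        x≰y : ¬ x ≤ y
        x≰y = proj₁ (All.lookup new xy∈E)

        rk-y : rk y ≡ rk x ℤ.+ 1ℤ
        rk-y = proj₂ (All.lookup new xy∈E)

        y≰x : ¬ y ≤ x
        y≰x y≤x = ℤₚ.<⇒≱ (i≡j+1⇒j<i rk-y) (≈⊎<⇒≤ (rank-strict y≤x))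

        step : CriticalStep x y
        step = criticalStep y≰x

        open CriticalStep step

        d u s : Carrier
        d = y ∧ m
        u = x ∨ d
        s = sup x d

        x⋖u : x ⋖ₚ u
        x⋖u = semimodular (x∧y≤x x d) (critical-⋖ step) y∧m≰x

        x≤′s : AddRelations P E x s
        x≤′s = proj₁ (IsLattice.supremum isLattice x d)

        d≤′s : AddRelations P E d s
        d≤′s = proj₁ (proj₂ (IsLattice.supremum isLattice x d))

        s-least : ∀ {z} → AddRelations P E x z → AddRelations P E d z → AddRelations P E s z
        s-least = proj₂ (proj₂ (IsLattice.supremum isLattice x d)) _

        x<s : rk x ℤ.< rk s
        x<s with added-strict new x≤′s
        ... | inj₂ x<s = x<s
        -- If `s` were `x`, then `d` would be below `x` in the new order. By minimality of `rk x`
        -- this already holds in `P`, against `y∧m≰x`.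
        ... | inj₁ x≈s with added⇒≤⊎aboveLowest new low (d≤′s ◅◅ (inj₁ (≤-reflexive (Eq.sym x≈s)) ◅ ε))
        ...   | inj₁ d≤x = contradiction d≤x y∧m≰x
        ...   | inj₂ x<x = contradiction x<x (ℤₚ.<-irrefl refl)

        s≈ : ∀ {z} → AddRelations P E s z → rk z ≡ rk x ℤ.+ 1ℤ → s ≈ z
        s≈ s≤′z rk-z with added-strict new s≤′z
        ... | inj₁ s≈z = s≈z
        -- No integer lies strictly between `rk x` and `rk x + 1`, so `rk s` cannot lie strictly
        -- below `rk z`.
        ... | inj₂ s<z = contradiction s<z (ℤₚ.≤⇒≯ (ℤₚ.≤-trans
          (ℤₚ.≤-reflexive (≡.trans rk-z (ℤₚ.+-comm (rk x) 1ℤ))) (ℤₚ.i<j⇒suc[i]≤j x<s)))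

        s≈u : s ≈ u
        s≈u = s≈ (s-least (inj₁ (x≤x∨y x d) ◅ ε) (inj₁ (y≤x∨y x d) ◅ ε)) (cover x⋖u)

        s≈y : s ≈ y
        s≈y = s≈ (s-least (inj₂ xy∈E ◅ ε) (inj₁ (x∧y≤x y m) ◅ ε)) rk-y

      maximal : IsMaximalWrt P rk
      maximal []      E≢[] _   = contradiction refl E≢[]
      -- The head `e` is the default value of `argmin`, so the minimum runs over the whole nonempty
      -- list.
      maximal (e ∷ E) _    new = lowest-¬lattice new lowest∈
        (f[argmin]≤f[⊤] {f = rk ∘ proj₁} e E ∷ f[argmin]≤f[xs] e E)
        where
        lowest∈ : argmin (rk ∘ proj₁) e E ∈ₚ e ∷ E
        lowest∈ with argmin-sel (rk ∘ proj₁) e E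
        ... | inj₁ eq = here eq
        ... | inj₂ ∈E = there ∈E

theorem4p9 : ∀ {c ℓ₁ ℓ₂} (P : Lattice c ℓ₁ ℓ₂) → IsFinite P →
    IsSupersolvable P → IsJoinDistributive P → IsMaximal P
theorem4p9 P finite (M , M-max , distributive) jd =
  (rank , rank-isRank) , λ rk isRank → maximal jd isRank
  where
  open FiniteLattice P finite
  open Supersolvable M M-max distributive
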